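{- For every $n\ge1$, the unimodal spi-logic $\mathsf{SPi}+\{\Diamond^n p\to q\}$ is complex, and hence complete, where $\Diamond^n$ denotes $n$ consecutive diamonds and $p,q$ are distinct variables.
   Context: Unimodal setting: one diamond $\Diamond$. Sp-formulas: built from propositional variables and $\top$ by $\wedge$ and $\Diamond$; sp-implications $\sigma\to\tau$. A SLO is an algebra $(A,\wedge,\top,\Diamond)$ with $(A,\wedge,\top)$ a meet-semilattice with top and $\Diamond$ monotone; it validates $\sigma\to\tau$ if $\sigma[\mathfrak a]\le\tau[\mathfrak a]$ for all valuations. Frames $(W,R)$ with standard Kripke semantics. $\mathsf{SPi}+\Sigma$ is the set of sp-implications valid in every SLO validating $\Sigma$; it is complete if it equals the set of sp-implications valid in every frame validating $\Sigma$. For a frame $\mathfrak F=(W,R)$, $\mathfrak F^\star=(2^W,\cap,W,\Diamond^+)$ with $\Diamond^+X=\{w\mid\exists v\in X,(w,v)\in R\}$; a spi-logic $L$ is complex if every SLO validating $L$ embeds (injectively, preserving $\wedge,\top,\Diamond$) into $\mathfrak F^\star$ for some frame $\mathfrak F$ validating $L$. -}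

module Defs where

open import Algebra.Core using (Op₁)
open import Algebra.Bundles.Raw using (RawMonoid)
open import Algebra.Lattice.Bundles using (BoundedMeetSemilattice)
open import Algebra.Morphism.Structures using (module MonoidMorphisms)
open import Data.Nat.Base using (ℕ; zero; suc)
open import Data.Product.Base using (Σ; ∃; _×_; _,_; proj₁; proj₂)
open import Data.Unit.Polymorphic.Base using (tt) renaming (⊤ to Unit)
open import Level using (Level; _⊔_) renaming (suc to lsuc)
open import Relation.Binary.Core using (Rel; _Preserves_⟶_)
import Relation.Binary.Construct.NaturalOrder.Left as NaturalOrder
open import Relation.Unary using (Pred; _∈_; _∩_; _≐_)
open import Relation.Unary.Algebra using (∩-isSemigroup; ∩-comm; ∩-idem)
open import Relation.Unary.Polymorphic using (U)

private
  variable
    c c′ ℓ ℓ′ : Level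

Var : Set
Var = ℕ

infixr 7 _∧′_
infix  5 _⇒_

data SpFormula : Set where
  var  : Var → SpFormula
  ⊤′   : SpFormula
  _∧′_ : SpFormula → SpFormula → SpFormula
  ◇′_  : SpFormula → SpFormula

record SpImplication : Set where
  constructor _⇒_
  field
    antecedent : SpFormula
    consequent : SpFormula

◇^ : ℕ → SpFormula → SpFormula
◇^ zero    φ = φ
◇^ (suc n) φ = ◇′ (◇^ n φ)

record SLO c ℓ : Set (lsuc (c ⊔ ℓ)) where
  field
    boundedMeetSemilattice : BoundedMeetSemilattice c ℓ

  open BoundedMeetSemilattice boundedMeetSemilattice public

  -- a ≤ b unfolds to a ≈ a ∧ b.
  open NaturalOrder _≈_ _∧_ public using (_≤_)

  field
    ◇      : Op₁ Carrier
    ◇-mono : ◇ Preserves _≤_ ⟶ _≤_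

  rawMonoid : RawMonoid c ℓ
  rawMonoid = record { Carrier = Carrier ; _≈_ = _≈_ ; _∙_ = _∧_ ; ε = ⊤ }

module _ (A : SLO c ℓ) where
  open SLO A

  eval : SpFormula → (Var → Carrier) → Carrier
  eval (var p)  𝔞 = 𝔞 p
  eval ⊤′       𝔞 = ⊤
  eval (φ ∧′ ψ) 𝔞 = eval φ 𝔞 ∧ eval ψ 𝔞
  eval (◇′ φ)   𝔞 = ◇ (eval φ 𝔞)

  SLO-validates : SpImplication → Set (c ⊔ ℓ)
  SLO-validates (σ ⇒ τ) = ∀ (𝔞 : Var → Carrier) → eval σ 𝔞 ≤ eval τ 𝔞

  SLO-validatesAll : Pred SpImplication ℓ′ → Set (c ⊔ ℓ ⊔ ℓ′)
  SLO-validatesAll Σ′ = ∀ ι → ι ∈ Σ′ → SLO-validates ι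

-- The set of worlds may be empty.  This is essential: the one-element SLO
-- validates ◇ⁿ p → q, but embeds into no 𝔉⋆ with 𝔉 nonempty and
-- validating ◇ⁿ p → q.
record Frame ℓ : Set (lsuc ℓ) where
  field
    W : Set ℓ
    R : Rel W ℓ

module _ (𝔉 : Frame ℓ) where
  open Frame 𝔉

  Sat : (Var → Pred W ℓ) → W → SpFormula → Set ℓ
  Sat V w (var p)  = w ∈ V p
  Sat V w ⊤′       = Unit
  Sat V w (φ ∧′ ψ) = Sat V w φ × Sat V w ψ
  Sat V w (◇′ φ)   = ∃ λ v → R w v × Sat V v φ

  Frame-validates : SpImplication → Set (lsuc ℓ)
  Frame-validates (σ ⇒ τ) = ∀ (V : Var → Pred W ℓ) (w : W) → Sat V w σ → Sat V w τ

  Frame-validatesAll : Pred SpImplication ℓ′ → Set (lsuc ℓ ⊔ ℓ′)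
  Frame-validatesAll Σ′ = ∀ ι → ι ∈ Σ′ → Frame-validates ι

  ◇⁺ : Pred W ℓ → Pred W ℓ
  ◇⁺ X w = ∃ λ v → v ∈ X × R w v

  -- 2^W is rendered as Pred W ℓ with extensional equality.
  _⋆ : SLO (lsuc ℓ) ℓ
  _⋆ = record
    { boundedMeetSemilattice = record
      { Carrier = Pred W ℓ
      ; _≈_     = _≐_
      ; _∧_     = _∩_
      ; ⊤       = U
      ; isBoundedMeetSemilattice = record
        { isCommutativeMonoid = record
          { isMonoid = record
            { isSemigroup = ∩-isSemigroup W ℓ
            ; identity    = (λ _ → proj₂ , (tt ,_)) , (λ _ → proj₁ , (_, tt))
            }
          ; comm = ∩-comm
          }
        ; idem = ∩-idem
        }
      }
    ; ◇      = ◇⁺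
    ; ◇-mono = λ (X⊆X∩Y , _) →
        (λ (v , v∈X , wRv) → (v , v∈X , wRv) , (v , proj₂ (X⊆X∩Y v∈X) , wRv)) , proj₁
    }

record IsSLOEmbedding (A : SLO c ℓ) (B : SLO c′ ℓ′)
                      (h : SLO.Carrier A → SLO.Carrier B) : Set (c ⊔ ℓ ⊔ ℓ′) where
  private
    module A = SLO A
    module B = SLO B
  open MonoidMorphisms A.rawMonoid B.rawMonoid using (IsMonoidMonomorphism)
  field
    isMonoidMonomorphism : IsMonoidMonomorphism h
    ◇-homo               : ∀ a → h (A.◇ a) B.≈ B.◇ (h a)

_Embeds-into_ : SLO c ℓ → SLO c′ ℓ′ → Set (c ⊔ ℓ ⊔ c′ ⊔ ℓ′)
A Embeds-into B = Σ (SLO.Carrier A → SLO.Carrier B) (IsSLOEmbedding A B)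

-- "Every SLO" and "every frame" range over structures in one universe ℓ;
-- 𝔉 ⋆ itself lives one universe higher, being carried by Pred W ℓ.
module _ (ℓ : Level) where

  SPi+ : Pred SpImplication ℓ′ → Pred SpImplication (lsuc ℓ ⊔ ℓ′)
  SPi+ Σ′ ι = ∀ (A : SLO ℓ ℓ) → SLO-validatesAll A Σ′ → SLO-validates A ι

  FrameConsequences : Pred SpImplication ℓ′ → Pred SpImplication (lsuc ℓ ⊔ ℓ′)
  FrameConsequences Σ′ ι =
    ∀ (𝔉 : Frame ℓ) → Frame-validatesAll 𝔉 Σ′ → Frame-validates 𝔉 ι

  Complete : Pred SpImplication ℓ′ → Set (lsuc ℓ ⊔ ℓ′)
  Complete Σ′ = SPi+ Σ′ ≐ FrameConsequences Σ′

  Complex : Pred SpImplication ℓ′ → Set (lsuc ℓ ⊔ ℓ′)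
  Complex L = ∀ (A : SLO ℓ ℓ) → SLO-validatesAll A L →
    ∃ λ (𝔉 : Frame ℓ) → Frame-validatesAll 𝔉 L × A Embeds-into (𝔉 ⋆)

{-# OPTIONS --safe #-}

-- In a SLO validating ◇ⁿ p → q with n ≥ 1, the element ◇ⁿ ⊤ is a bottom and
-- ◇ sends bottoms to bottoms.  Take as worlds the non-bottom elements, with
-- a R b iff a ≤ ◇ b.  A path of length n from a would give a ≤ ◇ⁿ b, making a
-- a bottom, so this frame validates ◇ⁿ p → q; and a ↦ { x | x ≤ a } embeds
-- the SLO into the dual of the frame.  Completeness follows since validity
-- transfers along embeddings.  Soundness cannot quantify over 𝔉 ⋆ itself,
-- which lies one universe too high; its subalgebra of sets definable under a
-- fixed valuation, carried by the formulas, is small and suffices.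

module Submission where

open import Defs
open import Algebra.Bundles.Raw using (RawMonoid)
open import Algebra.Morphism.Structures using (module MonoidMorphisms)
open import Algebra.Lattice.Structures using (module IsBoundedSemilattice)
import Algebra.Lattice.Properties.Semilattice as SemilatticeProperties
import Algebra.Morphism.MonoidMonomorphism as MonoidMonomorphism
open import Axiom.ExcludedMiddle using (ExcludedMiddle)
open import Data.Bool.Base using (if_then_else_)
open import Data.Empty using (⊥-elim)
open import Data.Nat.Base using (ℕ; zero; suc; _≥_; s≤s)
open import Data.Nat.GeneralisedArithmetic using (fold)
open import Data.Nat.Properties using (_≟_)
open import Data.Product.Base using (Σ; ∃; _×_; _,_; proj₁; proj₂)
open import Data.Unit.Polymorphic.Base using (tt)
open import Function.Base using (_∘_; id)
open import Level using (Level; Lift; lift; lower)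
open import Relation.Binary.Bundles using (Poset)
import Relation.Binary.Lattice.Bundles as OrderTheoretic
open import Relation.Binary.PropositionalEquality.Core using (_≡_; _≢_; refl; cong; subst₂)
open import Relation.Nullary.Decidable using (yes; no; does; dec-true; dec-false)
open import Relation.Nullary.Negation.Core using (¬_)
open import Relation.Unary using (Pred; ｛_｝; _∈_; _⊆_; _≐_)

private
  variable
    c ℓ ℓ′ : Level

-- Order and bottom elements in a SLO

module SLOProperties (A : SLO c ℓ) where
  open SLO A hiding (refl)
  open SemilatticeProperties semilattice using (poset; ∧-orderTheoreticMeetSemilattice)
  open Poset poset public
    using () renaming (refl to ≤-refl; trans to ≤-trans; antisym to ≤-antisym; reflexive to ≤-reflexive)
  open OrderTheoretic.MeetSemilattice ∧-orderTheoreticMeetSemilattice public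
    using (x∧y≤x; x∧y≤y; ∧-greatest)

  IsBottom : Carrier → Set _
  IsBottom a = ∀ b → a ≤ b

  eval-◇^ : ∀ n φ 𝔞 → eval A (◇^ n φ) 𝔞 ≡ fold (eval A φ 𝔞) ◇ n
  eval-◇^ zero    φ 𝔞 = refl
  eval-◇^ (suc n) φ 𝔞 = cong ◇ (eval-◇^ n φ 𝔞)

  ◇ⁿ-isBottom : ∀ n {p q} → p ≢ q → SLO-validates A (◇^ n (var p) ⇒ var q) →
                ∀ a → IsBottom (fold a ◇ n)
  ◇ⁿ-isBottom n {p} {q} p≢q valid a b =
    subst₂ _≤_ eval-antecedent eval-consequent (valid 𝔞)
    where
    𝔞 : Var → Carrier
    -- `p` receives `a` because `p ≢ q`, so the two sides of the implication can be chosen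
    -- independently.
    𝔞 v = if does (v ≟ q) then b else a

    eval-antecedent : eval A (◇^ n (var p)) 𝔞 ≡ fold a ◇ n
    eval-antecedent rewrite eval-◇^ n (var p) 𝔞 | dec-false (p ≟ q) p≢q = refl

    eval-consequent : 𝔞 q ≡ b
    eval-consequent rewrite dec-true (q ≟ q) refl = refl

-- Transfer of validity along embeddings

module EmbeddingProperties (A : SLO c ℓ) (𝔉 : Frame ℓ′) (embedding : A Embeds-into (𝔉 ⋆)) where
  open SLO A hiding (refl)
  open SLOProperties A
  open Frame 𝔉
  open MonoidMorphisms rawMonoid (SLO.rawMonoid (𝔉 ⋆)) using (module IsMonoidMonomorphism)
  open IsSLOEmbedding (proj₂ embedding)
  open IsMonoidMonomorphism isMonoidMonomorphism using (homo; ε-homo; injective; ⟦⟧-cong)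

  private
    h : Carrier → Pred W ℓ′
    h = proj₁ embedding

  h-mono : ∀ {a b} → a ≤ b → h a ⊆ h b
  h-mono a≤a∧b = proj₂ ∘ proj₁ (homo _ _) ∘ proj₁ (⟦⟧-cong a≤a∧b)

  -- The order is the equation `a ≈ a ∧ b`, so injectivity together with preservation of meets
  -- reflects it.
  h-cancel-≤ : ∀ {a b} → h a ⊆ h b → a ≤ b
  h-cancel-≤ ha⊆hb = injective
    ( (λ x∈ha → proj₂ (homo _ _) (x∈ha , ha⊆hb x∈ha))
    , proj₁ ∘ proj₁ (homo _ _)
    )

  h-eval : ∀ 𝔞 φ → h (eval A φ 𝔞) ≐ λ w → Sat 𝔉 (h ∘ 𝔞) w φ
  h-eval 𝔞 (var p)  = id , id
  h-eval 𝔞 ⊤′       = proj₁ ε-homo , proj₂ ε-homo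
  h-eval 𝔞 (φ ∧′ ψ) with h-eval 𝔞 φ | h-eval 𝔞 ψ
  ... | φ⊆ , φ⊇ | ψ⊆ , ψ⊇ =
      (λ x → let y , z = proj₁ (homo _ _) x in φ⊆ y , ψ⊆ z)
    , (λ (y , z) → proj₂ (homo _ _) (φ⊇ y , ψ⊇ z))
  h-eval 𝔞 (◇′ φ) with h-eval 𝔞 φ
  ... | φ⊆ , φ⊇ =
      (λ x → let v , y , wRv = proj₁ (◇-homo _) x in v , wRv , φ⊆ y)
    , (λ (v , wRv , y) → proj₂ (◇-homo _) (v , φ⊇ y , wRv))

  validates-reflects : ∀ ι → Frame-validates 𝔉 ι → SLO-validates A ι
  validates-reflects (σ ⇒ τ) valid 𝔞 =
    h-cancel-≤ (proj₂ (h-eval 𝔞 τ) ∘ valid (h ∘ 𝔞) _ ∘ proj₁ (h-eval 𝔞 σ))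

-- The small algebra of definable sets

module DefinableSets (𝔉 : Frame ℓ) (V : Var → Pred (Frame.W 𝔉) ℓ) where
  open Frame 𝔉

  ⟦_⟧ : Lift ℓ SpFormula → Pred W ℓ
  ⟦ φ ⟧ w = Sat 𝔉 V w (lower φ)

  private
    rawFormulas : RawMonoid ℓ ℓ
    rawFormulas = record
      { Carrier = Lift ℓ SpFormula
      ; _≈_     = λ φ ψ → ⟦ φ ⟧ ≐ ⟦ ψ ⟧
      ; _∙_     = λ φ ψ → lift (lower φ ∧′ lower ψ)
      ; ε       = lift ⊤′
      }

    module 𝔉⋆ = SLO (𝔉 ⋆)

    open MonoidMorphisms rawFormulas 𝔉⋆.rawMonoid using (IsMonoidMonomorphism)

    ⟦⟧-isMonoidMonomorphism : IsMonoidMonomorphism ⟦_⟧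
    ⟦⟧-isMonoidMonomorphism = record
      { isMonoidHomomorphism = record
        { isMagmaHomomorphism = record
          { isRelHomomorphism = record { cong = id }
          ; homo = λ _ _ → id , id
          }
        ; ε-homo = id , id
        }
      ; injective = id
      }

    open MonoidMonomorphism ⟦⟧-isMonoidMonomorphism using (isCommutativeMonoid)

  -- Formulas count as equal when they have the same extension under `V`; this makes `⟦_⟧` injective
  -- by definition, and the semilattice laws pull back along it.
  definable : SLO ℓ ℓ
  definable = record
    { boundedMeetSemilattice = record
      { isBoundedMeetSemilattice = record
        { isCommutativeMonoid = isCommutativeMonoid
            (IsBoundedSemilattice.isCommutativeMonoid 𝔉⋆.isBoundedMeetSemilattice)
        ; idem = λ φ → 𝔉⋆.idem ⟦ φ ⟧
        }
      }
    ; ◇      = λ φ → lift (◇′ lower φ)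
    ; ◇-mono = λ (φ⊆φ∧ψ , _) →
        (λ (v , wRv , x) → (v , wRv , x) , (v , wRv , proj₂ (φ⊆φ∧ψ x))) , proj₁
    }

  definable-embeds : definable Embeds-into (𝔉 ⋆)
  definable-embeds = ⟦_⟧ , record
    { isMonoidMonomorphism = ⟦⟧-isMonoidMonomorphism
    ; ◇-homo = λ _ → (λ (v , wRv , x) → v , x , wRv) , (λ (v , x , wRv) → v , wRv , x)
    }

-- Soundness, and completeness from complexity

axioms-valid : (Σ′ : Pred SpImplication ℓ′) → ∀ ι → ι ∈ Σ′ → ι ∈ SPi+ ℓ Σ′
axioms-valid Σ′ ι ι∈Σ′ A valid = valid ι ι∈Σ′

sound : (Σ′ : Pred SpImplication ℓ′) → ∀ ι → ι ∈ SPi+ ℓ Σ′ → ι ∈ FrameConsequences ℓ Σ′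
sound Σ′ (σ ⇒ τ) ι∈SPi+ 𝔉 valid V w w⊨σ =
  proj₁ (h-eval η τ) (h-mono {eval definable σ η} {eval definable τ η} σ≤τ (proj₂ (h-eval η σ) w⊨σ))
  where
  open DefinableSets 𝔉 V
  open EmbeddingProperties definable 𝔉 definable-embeds
  open SLO definable using (_≤_)

  -- Each variable denotes itself, so `⟦_⟧ ∘ η` is `V` and truth in the algebra is truth in the
  -- original model.
  η : Var → Lift _ SpFormula
  η = lift ∘ var

  σ≤τ : eval definable σ η ≤ eval definable τ η
  σ≤τ = ι∈SPi+ definable (λ ι ι∈Σ′ → validates-reflects ι (valid ι ι∈Σ′)) η

complex⇒complete : (Σ′ : Pred SpImplication ℓ′) → Complex ℓ (SPi+ ℓ Σ′) → Complete ℓ Σ′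
complex⇒complete Σ′ complex = (λ {ι} → sound Σ′ ι) , λ {ι} → complete ι
  where
  complete : ∀ ι → ι ∈ FrameConsequences _ Σ′ → ι ∈ SPi+ _ Σ′
  complete ι ι∈FC A valid with complex A (λ κ κ∈SPi+ → κ∈SPi+ A valid)
  ... | 𝔉 , 𝔉-valid , embedding =
    EmbeddingProperties.validates-reflects A 𝔉 embedding ι
      (ι∈FC 𝔉 (λ κ κ∈Σ′ → 𝔉-valid κ (axioms-valid Σ′ κ κ∈Σ′)))

-- The frame of non-bottom elements

module NonBottomFrame (A : SLO ℓ ℓ) where
  open SLO A hiding (refl)
  open SLOProperties A

  frame : Frame ℓ
  frame = record
    { W = Σ Carrier (λ a → ¬ IsBottom a)
    ; R = λ (a , _) (b , _) → a ≤ ◇ b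
    }

  open Frame frame

  -- The witness `b` is the endpoint of the path; monotonicity of `◇` stacks the inequalities of its
  -- steps.
  path-bound : ∀ n {V φ} {w : W} → Sat frame V w (◇^ n φ) → ∃ λ b → proj₁ w ≤ fold b ◇ n
  path-bound zero    {w = a , _} _             = a , ≤-refl
  path-bound (suc n) (_ , a≤◇v , v⊨) with path-bound n v⊨
  ... | b , v≤◇ⁿb = b , ≤-trans a≤◇v (◇-mono v≤◇ⁿb)

  frame-validates : ∀ n {φ ψ} → (∀ a → IsBottom (fold a ◇ n)) →
                    Frame-validates frame (◇^ n φ ⇒ ψ)
  frame-validates n ◇ⁿ-bottom V (a , a-nonbottom) w⊨ with path-bound n w⊨
  ... | b , a≤◇ⁿb = ⊥-elim (a-nonbottom (λ x → ≤-trans a≤◇ⁿb (◇ⁿ-bottom b x)))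

  ↓_ : Carrier → Pred W ℓ
  (↓ a) (x , _) = x ≤ a

  ↓-embeds : ExcludedMiddle ℓ → (∀ {a} → IsBottom a → IsBottom (◇ a)) →
             A Embeds-into (frame ⋆)
  ↓-embeds em ◇-bottom = ↓_ , record
    { isMonoidMonomorphism = record
      { isMonoidHomomorphism = record
        { isMagmaHomomorphism = record
          { isRelHomomorphism = record
            { cong = λ a≈b → (λ x≤a → ≤-trans x≤a (≤-reflexive a≈b))
                           , (λ x≤b → ≤-trans x≤b (≤-reflexive (sym a≈b)))
            }
          ; homo = λ a b → (λ x≤a∧b → ≤-trans x≤a∧b (x∧y≤x a b) , ≤-trans x≤a∧b (x∧y≤y a b))
                         , (λ (x≤a , x≤b) → ∧-greatest x≤a x≤b)
          }
        ; ε-homo = (λ _ → tt) , (λ {(x , _)} _ → sym (identityʳ x))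
        }
      ; injective = λ (↓a⊆↓b , ↓b⊆↓a) →
          ≤-antisym (↓-cancel-≤ λ {x} → ↓a⊆↓b {x}) (↓-cancel-≤ λ {x} → ↓b⊆↓a {x})
      }
    ; ◇-homo = λ a →
        (λ {(x , x-nonbottom)} x≤◇a →
          (a , λ a-bottom → x-nonbottom (λ b → ≤-trans x≤◇a (◇-bottom a-bottom b))) ,
          ≤-refl , x≤◇a)
      , (λ (_ , y≤a , x≤◇y) → ≤-trans x≤◇y (◇-mono y≤a))
    }
    where
    -- A bottom `a` lies below `b` outright; any other `a` is a world of `↓ a`, hence of `↓ b`.
    -- Excluded middle decides between the cases.
    ↓-cancel-≤ : ∀ {a b} → ↓ a ⊆ ↓ b → a ≤ b
    ↓-cancel-≤ {a} {b} ↓a⊆↓b with em {IsBottom a}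
    ... | yes a-bottom   = a-bottom b
    ... | no a-nonbottom = ↓a⊆↓b {a , a-nonbottom} ≤-refl

theorem5p24 : (ℓ : Level) → ExcludedMiddle ℓ → (n : ℕ) → n ≥ 1 → (p q : Var) → p ≢ q →
    Complex ℓ (SPi+ ℓ ｛ ◇^ n (var p) ⇒ var q ｝) × Complete ℓ ｛ ◇^ n (var p) ⇒ var q ｝
theorem5p24 ℓ em n@(suc m) (s≤s _) p q p≢q = complex , complex⇒complete Σ′ complex
  where
  ι₀ : SpImplication
  ι₀ = ◇^ n (var p) ⇒ var q

  Σ′ : Pred SpImplication _
  Σ′ = ｛ ι₀ ｝

  complex : Complex ℓ (SPi+ ℓ Σ′)
  complex A valid = frame , frame-validatesAll , ↓-embeds em ◇-bottom
    where
    open SLO A hiding (refl)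
    open SLOProperties A
    open NonBottomFrame A

    ◇ⁿ-bottom : ∀ a → IsBottom (fold a ◇ n)
    ◇ⁿ-bottom = ◇ⁿ-isBottom n p≢q (valid ι₀ (axioms-valid Σ′ ι₀ refl))

    -- A bottom lies below `m` diamonds over `⊤`, so its diamond lies below `n = suc m` of them,
    -- which is a bottom. This is where `n ≥ 1` enters.
    ◇-bottom : ∀ {a} → IsBottom a → IsBottom (◇ a)
    ◇-bottom a-bottom b =
      ≤-trans (◇-mono (a-bottom (fold ⊤ ◇ m))) (◇ⁿ-bottom ⊤ b)

    frame-validatesAll : Frame-validatesAll frame (SPi+ ℓ Σ′)
    frame-validatesAll ι ι∈SPi+ =
      -- Soundness reduces validity of the whole logic to that of its single axiom.
      sound Σ′ ι ι∈SPi+ frame λ where _ refl → frame-validates n ◇ⁿ-bottom
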